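{- Let $H$ be a locally easy graph. Then MIS admits a polynomial-time $\sqrt{\mathrm{OPT}}$-approximation algorithm on $H$-free graphs.
   Context: All graphs are finite and simple; $G$ is $H$-free if it has no induced subgraph isomorphic to $H$. MIS is the Maximum Independent Set problem; $\mathrm{OPT}=\alpha(G)$ is the maximum size of an independent set of the input graph $G$, and an $\mathrm{OPT}^{\beta}$-approximation outputs an independent set of size at least $\mathrm{OPT}^{1-\beta}$. A universal vertex of $H$ is a vertex adjacent to all other vertices. A graph $H$ is locally easy if it has a universal vertex $v$ such that there is a polynomial-time algorithm solving MIS exactly on $(H-\{v\})$-free graphs. -}

module Defs where

open import Data.Bool.Base using (Bool; true; false; T)
open import Data.Bool.Properties using (T?)
open import Data.Fin.Base using (Fin; zero; punchIn)
open import Data.Fin.Properties using (all?; punchIn-injective)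
open import Data.Fin.Subset using (Subset; inside; outside; _∈_; ∣_∣)
open import Data.Fin.Subset.Properties using (_∈?_)
open import Data.List.Base using (List; []; _∷_; _++_; map; filter)
open import Data.List.Extrema.Nat using (max)
open import Data.Nat.Base using (ℕ; zero; suc; pred; _+_; _*_; _^_; _≤_)
open import Data.Product.Base using (Σ-syntax; ∃-syntax; _×_; _,_)
open import Data.Vec.Base as Vec using (Vec; tabulate; replicate; lookup; _[_]≔_)
open import Function.Bundles using (_↣_; _↔_; mk↣; module Injection; module Inverse)
open import Relation.Binary.PropositionalEquality using (_≡_; _≢_)
open import Relation.Nullary.Decidable using (Dec; ¬?; _→-dec_)
open import Relation.Nullary.Negation using (¬_)

------------------------------------------------------------------------
-- Graphs

record Graph (n : ℕ) : Set where
  field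
    adj    : Fin n → Fin n → Bool
    sym    : ∀ u v → adj u v ≡ adj v u
    irrefl : ∀ v → adj v v ≡ false

  Adj : Fin n → Fin n → Set
  Adj u v = T (adj u v)

open Graph public

-- An induced subgraph on k vertices is given by an injective enumeration
-- of its vertex set, which also relabels these vertices by Fin k.
induced : ∀ {n k} → Graph n → Fin k ↣ Fin n → Graph k
induced G f = record
  { adj    = λ u v → adj G (to u) (to v)
  ; sym    = λ u v → sym G (to u) (to v)
  ; irrefl = λ v → irrefl G (to v)
  } where open Injection f using (to)

infix 4 _≅_

_≅_ : ∀ {m n} → Graph m → Graph n → Set
_≅_ {m} {n} G H = Σ[ φ ∈ Fin m ↔ Fin n ]
  (∀ u v → adj G u v ≡ adj H (Inverse.to φ u) (Inverse.to φ v))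

_-free : ∀ {m} → Graph m → (∀ {n} → Graph n → Set)
(H -free) {n} G = ∀ {k} (f : Fin k ↣ Fin n) → ¬ (induced G f ≅ H)

_-ᵥ_ : ∀ {n} → Graph n → Fin n → Graph (pred n)
_-ᵥ_ {suc n} G v = induced G (mk↣ (λ {i} {j} → punchIn-injective v i j))

Universal : ∀ {n} → Graph n → Fin n → Set
Universal G v = ∀ u → u ≢ v → Adj G v u

------------------------------------------------------------------------
-- Independent sets

Independent : ∀ {n} → Graph n → Subset n → Set
Independent G S = ∀ u v → u ∈ S → v ∈ S → ¬ Adj G u v

independent? : ∀ {n} (G : Graph n) (S : Subset n) → Dec (Independent G S)
independent? G S = all? λ u → all? λ v →
  (u ∈? S) →-dec ((v ∈? S) →-dec ¬? (T? (adj G u v)))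

allSubsets : ∀ n → List (Subset n)
allSubsets zero    = Vec.[] ∷ []
allSubsets (suc n) = map (inside Vec.∷_) (allSubsets n)
                  ++ map (outside Vec.∷_) (allSubsets n)

α : ∀ {n} → Graph n → ℕ
α {n} G = max 0 (map ∣_∣ (filter (independent? G) (allSubsets n)))

------------------------------------------------------------------------
-- The model of computation
--
-- Jones's WHILE language over binary trees (N. D. Jones, "Computability
-- and Complexity from a Programming Perspective"), with a finite number
-- of registers and a primitive conditional.  There is no equality test
-- on trees, so each operation takes constant time on a pointer
-- representation with sharing; for outputs of polynomial size (as here),
-- polynomial time in this model and on Turing machines is the same.

infixr 5 _•_

data Tree : Set where
  nil : Tree
  _•_ : Tree → Tree → Tree

head : Tree → Tree
head nil     = nil
head (a • b) = a

tail : Tree → Tree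
tail nil     = nil
tail (a • b) = b

Store : ℕ → Set
Store k = Vec Tree k

data Exp (k : ℕ) : Set where
  var   : Fin k → Exp k
  nil   : Exp k
  cons  : Exp k → Exp k → Exp k
  hd tl : Exp k → Exp k

eval : ∀ {k} → Exp k → Store k → Tree
eval (var x)    σ = lookup σ x
eval nil        σ = nil
eval (cons d e) σ = eval d σ • eval e σ
eval (hd e)     σ = head (eval e σ)
eval (tl e)     σ = tail (eval e σ)

cost : ∀ {k} → Exp k → ℕ
cost (var x)    = 1
cost nil        = 1
cost (cons d e) = 1 + (cost d + cost e)
cost (hd e)     = 1 + cost e
cost (tl e)     = 1 + cost e

infix  7 _≔_
infixr 6 _⨾_

data Cmd (k : ℕ) : Set where
  _≔_           : Fin k → Exp k → Cmd k
  _⨾_           : Cmd k → Cmd k → Cmd k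
  if_then_else_ : Exp k → Cmd k → Cmd k → Cmd k
  while_loop_     : Exp k → Cmd k → Cmd k

infix 4 ⟨_,_⟩⇓_after_

-- ⟨ C , σ ⟩⇓ τ after t : command C, started in store σ, halts in store τ
-- after t time units.  The tree nil counts as false, all others as true.
data ⟨_,_⟩⇓_after_ {k : ℕ} : Cmd k → Store k → Store k → ℕ → Set where
  assign : ∀ {x e σ} →
    ⟨ x ≔ e , σ ⟩⇓ σ [ x ]≔ eval e σ after 1 + cost e
  seq : ∀ {C D σ τ υ s t} →
    ⟨ C , σ ⟩⇓ τ after s →
    ⟨ D , τ ⟩⇓ υ after t →
    ⟨ C ⨾ D , σ ⟩⇓ υ after 1 + (s + t)
  if-true : ∀ {e C D σ τ a b t} →
    eval e σ ≡ a • b →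
    ⟨ C , σ ⟩⇓ τ after t →
    ⟨ if e then C else D , σ ⟩⇓ τ after 1 + (cost e + t)
  if-false : ∀ {e C D σ τ t} →
    eval e σ ≡ nil →
    ⟨ D , σ ⟩⇓ τ after t →
    ⟨ if e then C else D , σ ⟩⇓ τ after 1 + (cost e + t)
  while-true : ∀ {e C σ τ υ a b s t} →
    eval e σ ≡ a • b →
    ⟨ C , σ ⟩⇓ τ after s →
    ⟨ while e loop C , τ ⟩⇓ υ after t →
    ⟨ while e loop C , σ ⟩⇓ υ after 1 + (cost e + (s + t))
  while-false : ∀ {e C σ} →
    eval e σ ≡ nil →
    ⟨ while e loop C , σ ⟩⇓ σ after 1 + cost e

record Program : Set where
  field
    scratch : ℕ
    body    : Cmd (suc scratch)

-- Register zero holds the input at the start and the output at the end;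
-- all other registers start out as nil.
Runs : Program → Tree → Tree → ℕ → Set
Runs P input output t =
  ∃[ τ ] ⟨ body , input Vec.∷ replicate scratch nil ⟩⇓ τ after t
       × lookup τ zero ≡ output
  where open Program P

encodeBool : Bool → Tree
encodeBool false = nil
encodeBool true  = nil • nil

encodeVec : ∀ {A : Set} {n} → (A → Tree) → Vec A n → Tree
encodeVec enc Vec.[]       = nil
encodeVec enc (x Vec.∷ xs) = enc x • encodeVec enc xs

encodeSubset : ∀ {n} → Subset n → Tree
encodeSubset = encodeVec encodeBool

-- The adjacency matrix, as a list of rows.
encodeGraph : ∀ {n} → Graph n → Tree
encodeGraph G =
  encodeVec (encodeVec encodeBool) (tabulate λ u → tabulate (adj G u))

------------------------------------------------------------------------
-- Polynomial-time algorithms for MIS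

-- A polynomial-time algorithm that, on every graph G in the class 𝒞,
-- outputs a vertex set S satisfying Goal G S.  Nothing is required on
-- inputs outside 𝒞.  The input has size Θ(n²) (up to an additive
-- constant), so time polynomial in the input size is time polynomial in
-- the number n of vertices.
record PolyTimeAlgorithm (𝒞 : ∀ {n} → Graph n → Set)
                         (Goal : ∀ {n} → Graph n → Subset n → Set) : Set where
  field
    program : Program
    c d     : ℕ
    correct : ∀ {n} (G : Graph n) → 𝒞 G →
      ∃[ S ] ∃[ t ] Runs program (encodeGraph G) (encodeSubset S) t
                  × t ≤ c * n ^ d + c
                  × Goal G S

MaximumIndependent : ∀ {n} → Graph n → Subset n → Set
MaximumIndependent G S = Independent G S × ∣ S ∣ ≡ α G

-- An independent set of size at least OPT^(1 - 1/2); both sides of the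
-- inequality OPT^(1/2) ≤ ∣ S ∣ are squared.
√OPT-Approximate : ∀ {n} → Graph n → Subset n → Set
√OPT-Approximate G S = Independent G S × α G ≤ ∣ S ∣ ^ 2

LocallyEasy : ∀ {m} → Graph m → Set
LocallyEasy H = ∃[ v ] Universal H v
                     × PolyTimeAlgorithm ((H -ᵥ v) -free) MaximumIndependent

{-# OPTIONS --safe #-}

-- Let S be a maximal independent set, found greedily.  For every vertex w the
-- graph G[N(w)] is (H - v)-free, because w could play the role of the universal
-- vertex v, so a maximum independent set I(w) of G[N(w)] can be computed.  Let B
-- be a largest set among S and all I(w).  As S dominates G, an optimal set O is
-- covered by the sets O ∩ N[s] with s ∈ S, which have at most max(1, |I(s)|) ≤ |B|
-- elements.  Hence OPT ≤ |S| |B| ≤ |B|².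
module Submission where

open import Defs
open import Data.Bool.Base using (Bool; true; false; T; _∧_; _∨_)
open import Data.Bool.Properties using (T-≡)
open import Data.Empty using (⊥-elim)
open import Data.Fin.Base using (Fin; zero; suc; _↑ˡ_; _↑ʳ_; toℕ; punchIn; punchOut)
open import Data.Fin.Properties using (_≟_; punchIn-punchOut; punchOut-injective; suc-injective; toℕ-injective; toℕ<n)
open import Data.Fin.Subset using (Subset; inside; outside; ∣_∣; _∪_; _∩_; _─_; ⁅_⁆; ⊥; _∈_; _∉_)
open import Data.Fin.Subset.Properties
open import Data.List.Base as List using ()
open import Data.List.Extrema.Nat using (xs≤max; argmax-sel)
open import Data.List.Membership.Propositional using () renaming (_∈_ to _∈ᴸ_)
open import Data.List.Membership.Propositional.Properties using (∈-map⁺; ∈-map⁻; ∈-filter⁺; ∈-filter⁻; ∈-++⁺ˡ; ∈-++⁺ʳ)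
open import Data.List.Relation.Unary.All as All using ()
open import Data.List.Relation.Unary.Any using (here; there)
open import Data.Nat.Base using (ℕ; zero; suc; pred; _∸_; _+_; _*_; _^_; _≤_; _<_; s≤s; z≤n)
open import Data.Nat.Properties hiding (_≟_; suc-injective)
open import Data.Nat.Tactic.RingSolver using (solve-∀)
open import Data.Product.Base using (∃-syntax; _×_; _,_; proj₁; proj₂)
open import Data.Sum.Base using (_⊎_; inj₁; inj₂)
open import Data.Vec.Base using (Vec; []; _∷_; _++_; map; lookup; replicate; splitAt; tabulate; _[_]≔_; here; there)
open import Data.Vec.Properties using (map-id; tabulate-∘; tabulate-cong; lookup∘tabulate; []=⇒lookup; lookup⇒[]=; lookup-++ˡ; lookup-++ʳ; []≔-++-↑ˡ; []≔-++-↑ʳ)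
open import Function.Base using (_∘_; id)
open import Function.Bundles using (_↣_; mk↣; module Injection; module Inverse; module Equivalence)
open import Function.Construct.Identity using (↔-id)
open import Relation.Binary.PropositionalEquality as ≡ using (_≡_; _≢_; refl; cong; cong₂; subst; module ≡-Reasoning)
open import Relation.Nullary.Decidable using (yes; no)
open import Relation.Nullary.Negation using (¬_; contradiction)

-- Renaming registers

-- The covering argument is short; what shapes the development is that the algorithm must be an
-- explicit program with a time bound. The exact algorithm is an unknown program that expects `nil`
-- in its scratch registers, yet it is called once per vertex from inside a loop. Hence all code is
-- specified for arbitrary scratch contents, and the embedded program is preceded by code that
-- clears its registers. Apart from that program the only loop is a fold over a list, so running
-- times are obtained by composition.
--
-- The language has no equality test, and vertices have no names in the input. Loops therefore run
-- over the rows of the adjacency matrix: the row of w is the characteristic vector of N(w), ready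
-- to serve as a mask for extracting G[N(w)] and for translating I(w) back to G.

renameExp : ∀ {k l} → (Fin k → Fin l) → Exp k → Exp l
renameExp r (var x)    = var (r x)
renameExp r nil        = nil
renameExp r (cons d e) = cons (renameExp r d) (renameExp r e)
renameExp r (hd e)     = hd (renameExp r e)
renameExp r (tl e)     = tl (renameExp r e)

rename : ∀ {k l} → (Fin k → Fin l) → Cmd k → Cmd l
rename r (x ≔ e)              = r x ≔ renameExp r e
rename r (C ⨾ D)              = rename r C ⨾ rename r D
rename r (if e then C else D) = if renameExp r e then rename r C else rename r D
rename r (while e loop C)     = while renameExp r e loop rename r C

cost-rename : ∀ {k l} (r : Fin k → Fin l) e → cost (renameExp r e) ≡ cost e
cost-rename r (var x)    = refl
cost-rename r nil        = refl
cost-rename r (cons d e) = cong suc (cong₂ _+_ (cost-rename r d) (cost-rename r e))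
cost-rename r (hd e)     = cong suc (cost-rename r e)
cost-rename r (tl e)     = cong suc (cost-rename r e)

eval-rename : ∀ {k l} (r : Fin k → Fin l) {σ : Store k} {τ : Store l} →
  (∀ x → lookup τ (r x) ≡ lookup σ x) → ∀ e → eval (renameExp r e) τ ≡ eval e σ
eval-rename r p (var x)    = p x
eval-rename r p nil        = refl
eval-rename r p (cons d e) = cong₂ _•_ (eval-rename r p d) (eval-rename r p e)
eval-rename r p (hd e)     = cong head (eval-rename r p e)
eval-rename r p (tl e)     = cong tail (eval-rename r p e)

assignTo : ∀ {k x e v} {σ τ : Store k} → eval e σ ≡ v → σ [ x ]≔ v ≡ τ →
  ⟨ x ≔ e , σ ⟩⇓ τ after 1 + cost e
assignTo refl refl = assign

-- Everything that simulating a command inside a larger store requires. As `ι` fixes the contents of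
-- the other registers, the renamed command provably leaves them alone.
record Embedding {k l} (r : Fin k → Fin l) (ι : Store k → Store l) : Set where
  field
    lookup-embed : ∀ σ x → lookup (ι σ) (r x) ≡ lookup σ x
    update-embed : ∀ σ x v → ι σ [ r x ]≔ v ≡ ι (σ [ x ]≔ v)

open Embedding

rename-runs : ∀ {k l} {r : Fin k → Fin l} {ι} → Embedding r ι → ∀ {C σ τ t} →
  ⟨ C , σ ⟩⇓ τ after t → ⟨ rename r C , ι σ ⟩⇓ ι τ after t
-- The time index mentions `cost e`; rewriting it backwards to the cost of the renamed expression
-- lets the constructor apply.
rename-runs {r = r} E (assign {x} {e} {σ}) rewrite ≡.sym (cost-rename r e) =
  assignTo (eval-rename r (lookup-embed E σ) e) (update-embed E σ x _)
rename-runs E (seq c d) = seq (rename-runs E c) (rename-runs E d)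
rename-runs {r = r} E (if-true {e} {σ = σ} p c) rewrite ≡.sym (cost-rename r e) =
  if-true (≡.trans (eval-rename r (lookup-embed E σ) e) p) (rename-runs E c)
rename-runs {r = r} E (if-false {e} {σ = σ} p c) rewrite ≡.sym (cost-rename r e) =
  if-false (≡.trans (eval-rename r (lookup-embed E σ) e) p) (rename-runs E c)
rename-runs {r = r} E (while-true {e} {σ = σ} p c w) rewrite ≡.sym (cost-rename r e) =
  while-true (≡.trans (eval-rename r (lookup-embed E σ) e) p) (rename-runs E c) (rename-runs E w)
rename-runs {r = r} E (while-false {e} {σ = σ} p) rewrite ≡.sym (cost-rename r e) =
  while-false (≡.trans (eval-rename r (lookup-embed E σ) e) p)

left : ∀ {k l} (ρ : Store l) → Embedding (_↑ˡ l) (λ (σ : Store k) → σ ++ ρ)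
left ρ = record
  { lookup-embed = λ σ → lookup-++ˡ σ ρ
  ; update-embed = λ σ x v → []≔-++-↑ˡ σ ρ x
  }

right : ∀ {k l} (ρ : Store l) → Embedding (l ↑ʳ_) (λ (σ : Store k) → ρ ++ σ)
right ρ = record
  { lookup-embed = lookup-++ʳ ρ
  ; update-embed = λ σ x v → []≔-++-↑ʳ ρ σ x
  }

-- A combinator language

infixr 5 _⟫_

-- Register zero is both input and output, and expressions see only that register, so whatever a
-- later step needs travels inside one tree.
data Code : Set where
  exp       : Exp 1 → Code
  _⟫_ pair  : Code → Code → Code
  cond      : Exp 1 → Code → Code → Code
  fold      : Code → Code
  resetting : Program → Code

clear : ∀ k → Cmd (suc k)
clear zero    = zero ≔ nil
clear (suc k) = zero ≔ nil ⨾ rename suc (clear k)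

-- Two subprograms get disjoint blocks of registers; the `suc` accounts for register zero of the
-- second.
scratch : Code → ℕ
scratch (exp e)       = 0
scratch (P ⟫ Q)       = scratch P + suc (scratch Q)
scratch (pair P Q)    = scratch P + suc (scratch Q)
scratch (cond e P Q)  = scratch P + suc (scratch Q)
scratch (fold P)      = suc (scratch P)
scratch (resetting P) = suc (Program.scratch P)

body : (P : Code) → Cmd (suc (scratch P))
body (exp e) = zero ≔ e
body (P ⟫ Q) =
    rename (_↑ˡ suc (scratch Q)) (body P) ⨾ q ≔ var zero
  ⨾ rename (suc (scratch P) ↑ʳ_) (body Q) ⨾ zero ≔ var q
  where q = suc (scratch P) ↑ʳ zero
-- The input is copied into the block of `Q` first, because `P` overwrites register zero with its
-- output.
body (pair P Q) =
    q ≔ var zero ⨾ rename (_↑ˡ suc (scratch Q)) (body P)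
  ⨾ rename (suc (scratch P) ↑ʳ_) (body Q) ⨾ zero ≔ cons (var zero) (var q)
  where q = suc (scratch P) ↑ʳ zero
body (cond e P Q) =
  if renameExp (λ _ → zero) e
  then rename (_↑ˡ suc (scratch Q)) (body P)
  else (q ≔ var zero ⨾ rename (suc (scratch P) ↑ʳ_) (body Q) ⨾ zero ≔ var q)
  where q = suc (scratch P) ↑ʳ zero
-- The input is a list paired with an initial accumulator and an environment;
-- P maps an element, the accumulator and the environment to the new accumulator.
body (fold P) =
    while hd (var zero)
    loop (suc zero ≔ cons (hd (hd (var zero))) (tl (var zero))
        ⨾ rename suc (body P)
        ⨾ zero ≔ cons (tl (hd (var zero))) (cons (var (suc zero)) (tl (tl (var zero)))))
  ⨾ zero ≔ hd (tl (var zero))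
-- Clearing also erases the input register of the embedded program, so the input waits in register
-- zero, outside its block.
body (resetting P) =
    rename suc (clear (Program.scratch P)) ⨾ suc zero ≔ var zero
  ⨾ rename suc (Program.body P) ⨾ zero ≔ var (suc zero)

compile : Code → Program
compile P = record { scratch = scratch P ; body = body P }

infix 4 _[_]↦_⟨_⟩

-- Unlike Runs, this allows arbitrary initial contents of the scratch registers,
-- so that code can be run repeatedly in a loop.
record _[_]↦_⟨_⟩ (P : Code) (x y : Tree) (t : ℕ) : Set where
  field
    run : ∀ ρ → ∃[ ρ′ ] ∃[ s ] ⟨ body P , x ∷ ρ ⟩⇓ y ∷ ρ′ after s × s ≤ t

open _[_]↦_⟨_⟩

weaken : ∀ {P x y t u} → t ≤ u → P [ x ]↦ y ⟨ t ⟩ → P [ x ]↦ y ⟨ u ⟩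
weaken t≤u p .run ρ = let ρ′ , s , d , s≤t = run p ρ in ρ′ , s , d , ≤-trans s≤t t≤u

retime : ∀ {P x y t u} → t ≡ u → P [ x ]↦ y ⟨ t ⟩ → P [ x ]↦ y ⟨ u ⟩
retime refl p = p

returns : ∀ {P x y z t} → y ≡ z → P [ x ]↦ y ⟨ t ⟩ → P [ x ]↦ z ⟨ t ⟩
returns refl p = p

exp-runs : ∀ e {x} → exp e [ x ]↦ eval e (x ∷ []) ⟨ 1 + cost e ⟩
exp-runs e .run [] = [] , _ , assign , ≤-refl

-- The overhead 7 consists of three sequencing steps and two register copies of cost 2 each. The
-- constants in the following rules arise in the same way.
⟫-runs : ∀ {P Q x y z t u} → P [ x ]↦ y ⟨ t ⟩ → Q [ y ]↦ z ⟨ u ⟩ → (P ⟫ Q) [ x ]↦ z ⟨ 7 + (t + u) ⟩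
⟫-runs {P} {Q} {x} {y} {z} {t} {u} p q .run ρ with splitAt (scratch P) ρ
... | ρ₁ , w ∷ ρ₂ , refl with run p ρ₁ | run q ρ₂
... | ρ₁′ , s₁ , d₁ , s₁≤t | ρ₂′ , s₂ , d₂ , s₂≤u =
  _ , _ ,
  seq (rename-runs (left (w ∷ ρ₂)) d₁)
  (seq (assignTo refl ([]≔-++-↑ʳ (y ∷ ρ₁′) (w ∷ ρ₂) zero))
  (seq (rename-runs (right (y ∷ ρ₁′)) d₂)
  (assignTo (lookup-++ʳ (y ∷ ρ₁′) (z ∷ ρ₂′) zero) refl))) ,
  ≤-trans (≤-reflexive (lemma s₁ s₂)) (+-monoʳ-≤ 7 (+-mono-≤ s₁≤t s₂≤u))
  where
  lemma : ∀ a b → 1 + (a + (1 + (2 + (1 + (b + 2))))) ≡ 7 + (a + b)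
  lemma = solve-∀

pair-runs : ∀ {P Q x y z t u} → P [ x ]↦ y ⟨ t ⟩ → Q [ x ]↦ z ⟨ u ⟩ →
  pair P Q [ x ]↦ y • z ⟨ 9 + (t + u) ⟩
pair-runs {P} {Q} {x} {y} {z} {t} {u} p q .run ρ with splitAt (scratch P) ρ
... | ρ₁ , w ∷ ρ₂ , refl with run p ρ₁ | run q ρ₂
... | ρ₁′ , s₁ , d₁ , s₁≤t | ρ₂′ , s₂ , d₂ , s₂≤u =
  _ , _ ,
  seq (assignTo refl ([]≔-++-↑ʳ (x ∷ ρ₁) (w ∷ ρ₂) zero))
  (seq (rename-runs (left (x ∷ ρ₂)) d₁)
  (seq (rename-runs (right (y ∷ ρ₁′)) d₂)
  (assignTo (cong (y •_) (lookup-++ʳ (y ∷ ρ₁′) (z ∷ ρ₂′) zero)) refl))) ,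
  ≤-trans (≤-reflexive (lemma s₁ s₂)) (+-monoʳ-≤ 9 (+-mono-≤ s₁≤t s₂≤u))
  where
  lemma : ∀ a b → 1 + (2 + (1 + (a + (1 + (b + 4))))) ≡ 9 + (a + b)
  lemma = solve-∀

eval-test : ∀ {k} e {x} {ρ : Store k} → eval (renameExp (λ _ → zero) e) (x ∷ ρ) ≡ eval e (x ∷ [])
eval-test e = eval-rename _ (λ { zero → refl }) e

cond-true : ∀ {e P Q x y a b t} → eval e (x ∷ []) ≡ a • b → P [ x ]↦ y ⟨ t ⟩ →
  cond e P Q [ x ]↦ y ⟨ 7 + (cost e + t) ⟩
cond-true {e} {P} {Q} {t = t} eq p .run ρ with splitAt (scratch P) ρ
... | ρ₁ , w ∷ ρ₂ , refl with run p ρ₁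
... | ρ₁′ , s₁ , d₁ , s₁≤t =
  _ , _ , if-true (≡.trans (eval-test e) eq) (rename-runs (left (w ∷ ρ₂)) d₁) ,
  -- The overhead is only 1 here; 7 is that of the false branch, so that both branches share one
  -- form of bound.
  +-mono-≤ {1} {7} (s≤s z≤n) (+-mono-≤ (≤-reflexive (cost-rename _ e)) s₁≤t)

cond-false : ∀ {e P Q x y t} → eval e (x ∷ []) ≡ nil → Q [ x ]↦ y ⟨ t ⟩ →
  cond e P Q [ x ]↦ y ⟨ 7 + (cost e + t) ⟩
cond-false {e} {P} {Q} {x} {y} {t} eq q .run ρ with splitAt (scratch P) ρ
... | ρ₁ , w ∷ ρ₂ , refl with run q ρ₂
... | ρ₂′ , s₂ , d₂ , s₂≤t =
  _ , _ ,
  if-false (≡.trans (eval-test e) eq)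
    (seq (assignTo refl ([]≔-++-↑ʳ (x ∷ ρ₁) (w ∷ ρ₂) zero))
    (seq (rename-runs (right (x ∷ ρ₁)) d₂)
    (assignTo (lookup-++ʳ (x ∷ ρ₁) (y ∷ ρ₂′) zero) refl))) ,
  ≤-trans (≤-reflexive (lemma _ s₂)) (+-monoʳ-≤ 7 (+-mono-≤ (≤-reflexive (cost-rename _ e)) s₂≤t))
  where
  lemma : ∀ a b → 1 + (a + (1 + (2 + (1 + (b + 2))))) ≡ 7 + (a + b)
  lemma = solve-∀

clearTime : ℕ → ℕ
clearTime zero    = 2
clearTime (suc k) = 3 + clearTime k

clear-runs : ∀ k σ → ⟨ clear k , σ ⟩⇓ replicate (suc k) nil after clearTime k
clear-runs zero    (x ∷ []) = assign
clear-runs (suc k) (x ∷ σ)  = seq assign (rename-runs (right (nil ∷ [])) (clear-runs k σ))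

resetTime : Program → ℕ
resetTime P = 7 + clearTime (Program.scratch P)

-- After clearing and copying, the block of `P` is exactly the initial store prescribed by `Runs`,
-- whatever it held before.
resetting-runs : ∀ {P x y t} → Runs P x y t → resetting P [ x ]↦ y ⟨ resetTime P + t ⟩
resetting-runs {P} {x} {y} {t} (y ∷ τ , d , refl) .run (w ∷ ρ) =
  _ , _ ,
  seq (rename-runs (right (x ∷ [])) (clear-runs (Program.scratch P) (w ∷ ρ)))
  (seq assign
  (seq (rename-runs (right (x ∷ [])) d)
  assign)) ,
  ≤-reflexive (lemma (clearTime (Program.scratch P)) t)
  where
  lemma : ∀ a b → 1 + (a + (1 + (2 + (1 + (b + 2))))) ≡ (7 + a) + b
  lemma = solve-∀

fold-nil : ∀ {P acc env} → fold P [ nil • (acc • env) ]↦ acc ⟨ 8 ⟩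
fold-nil .run ρ = _ , _ , seq (while-false refl) assign , ≤-refl

-- The run on the shorter list is split into its loop and the final projection, and one more
-- iteration is put in front of the loop. That run must start from the scratch contents left by `P`,
-- hence the quantification over `ρ` in `run`.
fold-cons : ∀ {P a as acc acc′ env y t u} →
  P [ a • (acc • env) ]↦ acc′ ⟨ t ⟩ →
  fold P [ as • (acc′ • env) ]↦ y ⟨ u ⟩ →
  fold P [ (a • as) • (acc • env) ]↦ y ⟨ (22 + t) + u ⟩
fold-cons {P} {a} {as} {acc} {acc′} {env} {t = t} {u} p q .run (w ∷ ρ) with run p ρ
... | ρ₁ , s₁ , d₁ , s₁≤t with run q (acc′ ∷ ρ₁)
... | ρ₂ , _ , seq {s = s₂} {t = s₃} d₂ d₃ , s₂₃≤u =
  ρ₂ , _ ,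
  seq (while-true refl (seq assign (seq (rename-runs (right (x ∷ [])) d₁) assign)) d₂) d₃ ,
  ≤-trans (≤-reflexive (lemma s₁ s₂ s₃)) (+-mono-≤ (+-monoʳ-≤ 22 s₁≤t) s₂₃≤u)
  where
  x = (a • as) • (acc • env)
  lemma : ∀ a b c → 1 + ((1 + (2 + ((1 + (7 + (1 + (a + 10)))) + b))) + c) ≡ (22 + a) + (1 + (b + c))
  lemma = solve-∀

-- The loop invariant rule, with `I k` holding after k elements; each induction step shifts the
-- invariant by one. It serves the loops over vertices, since `encodeGraph G` is a tabulated list of
-- rows.
fold-tabulate : ∀ {A : Set} {P n t env} (I : ℕ → Tree → Set) (enc : A → Tree) (f : Fin n → A) →
  (∀ i {acc} → I (toℕ i) acc →
    ∃[ acc′ ] P [ enc (f i) • (acc • env) ]↦ acc′ ⟨ t ⟩ × I (suc (toℕ i)) acc′) →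
  ∀ {acc} → I 0 acc →
  ∃[ acc′ ] fold P [ encodeVec enc (tabulate f) • (acc • env) ]↦ acc′ ⟨ n * (22 + t) + 8 ⟩ × I n acc′
fold-tabulate {n = zero}  I enc f step i = _ , fold-nil , i
fold-tabulate {n = suc n} {t} I enc f step i =
  let acc₁ , p , i₁ = step zero i
      acc₂ , q , i₂ = fold-tabulate (λ k → I (suc k)) enc (λ j → f (suc j)) (λ j → step (suc j)) i₁
  in acc₂ , retime (lemma n t) (fold-cons p q) , i₂
  where
  lemma : ∀ n t → (22 + t) + (n * (22 + t) + 8) ≡ (22 + t + n * (22 + t)) + 8
  lemma = solve-∀

-- Right folds over two lists in parallel

x₀ : Exp 1
x₀ = var zero

-- Maps `x • ((out • Y) • env)` to `((x • head Y) • out) • tail Y`: only the first list drives the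
-- loop, so the second is consumed inside the accumulator.
zipStep : Exp 1
zipStep = cons (cons (cons (hd x₀) (hd (tl (hd (tl x₀))))) (hd (hd (tl x₀)))) (tl (tl (hd (tl x₀))))

-- Zipping reverses the order, so the left fold that follows is a right fold.
foldr₂ : Code → Code
foldr₂ P =
  pair (exp (cons (hd (hd x₀)) (cons (cons nil (tl (hd x₀))) nil)) ⟫ fold (exp zipStep) ⟫ exp (hd x₀))
       (exp (tl x₀))
  ⟫ fold P

revZip : ∀ {A : Set} {n} → (A → Tree) → Vec A n → Tree → Tree → Tree
revZip enc []       Y out = out
revZip enc (x ∷ xs) Y out = revZip enc xs (tail Y) ((enc x • head Y) • out)

revZip-runs : ∀ {A : Set} {n} (enc : A → Tree) (xs : Vec A n) {Y out env} →
  ∃[ Z ] fold (exp zipStep) [ encodeVec enc xs • ((out • Y) • env) ]↦ revZip enc xs Y out • Z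
         ⟨ n * 42 + 8 ⟩
revZip-runs enc []       = _ , fold-nil
revZip-runs enc (x ∷ xs) = _ , fold-cons (exp-runs zipStep) (proj₂ (revZip-runs enc xs))

-- Y may be longer than ys, and also shorter if the missing elements are encoded
-- by nil, since head nil and tail nil are nil.
data _Represents_by_ {B : Set} : ∀ {n} → Tree → Vec B n → (B → Tree) → Set where
  []  : ∀ {Y enc} → Y Represents [] by enc
  _∷_ : ∀ {Y n} {y} {ys : Vec B n} {enc} →
    head Y ≡ enc y → tail Y Represents ys by enc → Y Represents y ∷ ys by enc

encodeVec-represents : ∀ {B : Set} (enc : B → Tree) {n} (ys : Vec B n) → encodeVec enc ys Represents ys by enc
encodeVec-represents enc []       = []
encodeVec-represents enc (y ∷ ys) = refl ∷ encodeVec-represents enc ys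

nil-represents : ∀ n → nil Represents (⊥ {n}) by encodeBool
nil-represents zero    = []
nil-represents (suc n) = refl ∷ nil-represents n

module _ {A B : Set} {P : Code} {encA : A → Tree} {encB : B → Tree} {env : Tree} {t : ℕ}
  (g : ∀ {n} → Vec A n → Vec B n → Tree)
  (step : ∀ {n} x y (xs : Vec A n) (ys : Vec B n) →
    P [ (encA x • encB y) • (g xs ys • env) ]↦ g (x ∷ xs) (y ∷ ys) ⟨ t ⟩)
  where

  -- The reversed list presents the last pair first, so the accumulator grows from `g [] []` to
  -- `g xs ys`. Generalising over the fold that remains on `out` makes the induction work: the head
  -- pair is the last one folded before `out`.
  fold-revZip : ∀ {n} (xs : Vec A n) {Y} {ys : Vec B n} → Y Represents ys by encB → ∀ {out z u} →
    fold P [ out • (g xs ys • env) ]↦ z ⟨ u ⟩ →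
    fold P [ revZip encA xs Y out • (g [] [] • env) ]↦ z ⟨ n * (22 + t) + u ⟩
  fold-revZip []       []       k = k
  fold-revZip {suc n} (x ∷ xs) {ys = y ∷ ys} (eq ∷ r) {u = u} k rewrite eq =
    retime (lemma n t u) (fold-revZip xs r (fold-cons (step x y xs ys) k))
    where
    lemma : ∀ n t u → n * (22 + t) + ((22 + t) + u) ≡ ((22 + t) + n * (22 + t)) + u
    lemma = solve-∀

  foldr₂-runs : ∀ {n} (xs : Vec A n) {Y} {ys : Vec B n} → Y Represents ys by encB →
    foldr₂ P [ (encodeVec encA xs • Y) • (g [] [] • env) ]↦ g xs ys ⟨ n * (64 + t) + 64 ⟩
  foldr₂-runs {n} xs r =
    retime (lemma n t)
    (⟫-runs (pair-runs
      (⟫-runs (exp-runs _) (⟫-runs (proj₂ (revZip-runs encA xs)) (exp-runs (hd x₀))))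
      (exp-runs (tl x₀)))
    (fold-revZip xs r fold-nil))
    where
    lemma : ∀ n t → 7 + ((9 + ((7 + (12 + (7 + ((n * 42 + 8) + 3)))) + 3)) + (n * (22 + t) + 8)) ≡ n * (64 + t) + 64
    lemma = solve-∀

-- Subprograms on characteristic vectors

compress : ∀ {A : Set} {n} (M : Subset n) → Vec A n → Vec A ∣ M ∣
compress []          []       = []
compress (true ∷ M)  (x ∷ xs) = x ∷ compress M xs
compress (false ∷ M) (x ∷ xs) = compress M xs

selectStep : Code → Code
selectStep f = cond (hd (hd x₀))
  (pair (exp (cons (tl (hd x₀)) (tl (tl x₀))) ⟫ f) (exp (hd (tl x₀))))
  (exp (hd (tl x₀)))

select : Code → Code
select f = exp (cons (hd x₀) (cons nil (tl x₀))) ⟫ foldr₂ (selectStep f)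

select-runs : ∀ {A C : Set} {encA : A → Tree} {encC : C → Tree} {f env t} (h : A → C) →
  (∀ x → f [ encA x • env ]↦ encC (h x) ⟨ t ⟩) →
  ∀ {n} (M : Subset n) (xs : Vec A n) →
  select f [ (encodeSubset M • encodeVec encA xs) • env ]↦ encodeVec encC (map h (compress M xs))
    ⟨ n * (102 + t) + 79 ⟩
select-runs {A} {encA = encA} {encC} {f} {env} {t} h f-runs {n} M xs =
  retime (lemma n t) (⟫-runs (exp-runs _) (foldr₂-runs g step M (encodeVec-represents encA xs)))
  where
  lemma : ∀ n t → 7 + (8 + (n * (64 + (38 + t)) + 64)) ≡ n * (102 + t) + 79
  lemma = solve-∀
  lemma′ : ∀ t → 7 + (3 + (9 + (7 + (8 + t) + 4))) ≡ 38 + t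
  lemma′ = solve-∀
  g : ∀ {n} → Subset n → Vec A n → Tree
  g M xs = encodeVec encC (map h (compress M xs))
  step : ∀ {n} b x (M : Subset n) (xs : Vec A n) →
    selectStep f [ (encodeBool b • encA x) • (g M xs • env) ]↦ g (b ∷ M) (x ∷ xs) ⟨ 38 + t ⟩
  step true  x M xs = retime (lemma′ t)
    (cond-true refl (pair-runs (⟫-runs (exp-runs _) (f-runs x)) (exp-runs _)))
  step false x M xs = weaken (≤-trans (≤ᵇ⇒≤ 14 38 _) (m≤m+n 38 t)) (cond-false refl (exp-runs _))

meets : ∀ {n} → Subset n → Subset n → Bool
meets []       []       = false
meets (x ∷ xs) (y ∷ ys) = (x ∧ y) ∨ meets xs ys

meetsStep : Code
meetsStep = cond (hd (hd x₀))
  (cond (tl (hd x₀)) (exp (cons nil nil)) (exp (hd (tl x₀))))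
  (exp (hd (tl x₀)))

meetsCode : Code
meetsCode = exp (cons x₀ (cons nil nil)) ⟫ foldr₂ meetsStep

meets-runs : ∀ {n} (M S : Subset n) →
  meetsCode [ encodeSubset M • encodeSubset S ]↦ encodeBool (meets M S) ⟨ n * 88 + 77 ⟩
meets-runs {n} M S =
  retime (lemma n)
  (⟫-runs (exp-runs _) (foldr₂-runs (λ M S → encodeBool (meets M S)) step M (encodeVec-represents encodeBool S)))
  where
  lemma : ∀ n → 7 + (6 + (n * (64 + 24) + 64)) ≡ n * 88 + 77
  lemma = solve-∀
  step : ∀ {n} b c (M S : Subset n) →
    meetsStep [ (encodeBool b • encodeBool c) • (encodeBool (meets M S) • nil) ]↦
      encodeBool (meets (b ∷ M) (c ∷ S)) ⟨ 24 ⟩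
  step true  true  M S = cond-true refl (cond-true refl (exp-runs _))
  step true  false M S = cond-true refl (cond-false refl (exp-runs _))
  step false c     M S = weaken (≤ᵇ⇒≤ 14 24 _) (cond-false refl (exp-runs _))

unionStep : Code
unionStep = cond (tl (hd x₀)) (exp (cons (cons nil nil) (hd (tl x₀)))) (exp (cons (hd (hd x₀)) (hd (tl x₀))))

unionCode : Code
unionCode = exp (cons x₀ (cons nil nil)) ⟫ foldr₂ unionStep

-- The second argument is merely represented, so that a tree with fewer than n entries can stand for
-- a singleton.
union-runs : ∀ {n} (M : Subset n) {Y} {S : Subset n} → Y Represents S by encodeBool →
  unionCode [ encodeSubset M • Y ]↦ encodeSubset (M ∪ S) ⟨ n * 82 + 77 ⟩
union-runs {n} M r =
  retime (lemma n) (⟫-runs (exp-runs _) (foldr₂-runs (λ M S → encodeSubset (M ∪ S)) step M r))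
  where
  lemma : ∀ n → 7 + (6 + (n * (64 + 18) + 64)) ≡ n * 82 + 77
  lemma = solve-∀
  step : ∀ {n} b c (M S : Subset n) →
    unionStep [ (encodeBool b • encodeBool c) • (encodeSubset (M ∪ S) • nil) ]↦
      encodeSubset ((b ∷ M) ∪ (c ∷ S)) ⟨ 18 ⟩
  step true  true  M S = cond-true refl (exp-runs _)
  step false true  M S = cond-true refl (exp-runs _)
  step true  false M S = cond-false refl (exp-runs _)
  step false false M S = cond-false refl (exp-runs _)

-- The input does not state the number of vertices; the all-`false` vector is built by one `nil` per
-- list element.
emptyCode : Code
emptyCode = exp (cons (cons x₀ nil) (cons nil nil)) ⟫ foldr₂ (exp (cons nil (hd (tl x₀))))

empty-runs : ∀ {A : Set} (enc : A → Tree) {n} (xs : Vec A n) →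
  emptyCode [ encodeVec enc xs ]↦ encodeSubset (⊥ {n}) ⟨ n * 70 + 79 ⟩
empty-runs enc {n} xs =
  retime (lemma n)
  (⟫-runs (exp-runs _) (foldr₂-runs (λ {m} _ _ → encodeSubset (⊥ {m})) (λ _ _ _ _ → exp-runs _) xs (nil-represents n)))
  where
  lemma : ∀ n → 7 + (8 + (n * (64 + 6) + 64)) ≡ n * 70 + 79
  lemma = solve-∀

unary : ℕ → Tree
unary zero    = nil
unary (suc n) = nil • unary n

tail-unary : ∀ n → tail (unary n) ≡ unary (pred n)
tail-unary zero    = refl
tail-unary (suc n) = refl

countStep : Code
countStep = cond (hd (hd x₀)) (exp (cons nil (hd (tl x₀)))) (exp (hd (tl x₀)))

countCode : Code
countCode = exp (cons (cons x₀ nil) (cons nil nil)) ⟫ foldr₂ countStep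

count-runs : ∀ {n} (S : Subset n) → countCode [ encodeSubset S ]↦ unary ∣ S ∣ ⟨ n * 80 + 79 ⟩
count-runs {n} S =
  retime (lemma n)
  (⟫-runs (exp-runs _) (foldr₂-runs (λ S _ → unary ∣ S ∣) step S (nil-represents n)))
  where
  lemma : ∀ n → 7 + (8 + (n * (64 + 16) + 64)) ≡ n * 80 + 79
  lemma = solve-∀
  step : ∀ {n} b c (S Z : Subset n) →
    countStep [ (encodeBool b • encodeBool c) • (unary ∣ S ∣ • nil) ]↦ unary ∣ b ∷ S ∣ ⟨ 16 ⟩
  step true  c S Z = cond-true refl (exp-runs _)
  step false c S Z = weaken (≤ᵇ⇒≤ 14 16 _) (cond-false refl (exp-runs _))

-- Sizes are compared in unary. Taking one tail per element of the set is truncated subtraction,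
-- because `tail nil` is `nil`.
monusStep : Code
monusStep = cond (hd (hd x₀)) (exp (tl (hd (tl x₀)))) (exp (hd (tl x₀)))

monusCode : Code
monusCode = exp (cons (cons (hd x₀) nil) (cons (tl x₀) nil)) ⟫ foldr₂ monusStep

monus-runs : ∀ {n} (S : Subset n) k →
  monusCode [ encodeSubset S • unary k ]↦ unary (k ∸ ∣ S ∣) ⟨ n * 79 + 81 ⟩
monus-runs {n} S k =
  retime (lemma n)
  (⟫-runs (exp-runs _) (foldr₂-runs (λ S _ → unary (k ∸ ∣ S ∣)) step S (nil-represents n)))
  where
  lemma : ∀ n → 7 + (10 + (n * (64 + 15) + 64)) ≡ n * 79 + 81
  lemma = solve-∀
  step : ∀ {n} b c (S Z : Subset n) →
    monusStep [ (encodeBool b • encodeBool c) • (unary (k ∸ ∣ S ∣) • nil) ]↦ unary (k ∸ ∣ b ∷ S ∣) ⟨ 15 ⟩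
  step true  c S Z = returns
    (≡.trans (tail-unary (k ∸ ∣ S ∣)) (cong unary (pred[m∸n]≡m∸[1+n] k ∣ S ∣)))
    (cond-true refl (exp-runs _))
  step false c S Z = weaken (≤ᵇ⇒≤ 14 15 _) (cond-false refl (exp-runs _))

largerCode : Code
largerCode = pair (pair (exp (hd x₀)) (exp (tl x₀) ⟫ countCode) ⟫ monusCode) (exp x₀)
  ⟫ cond (hd x₀) (exp (tl (tl x₀))) (exp (hd (tl x₀)))

compared : ∀ {n} (S S′ : Subset n) →
  pair (pair (exp (hd x₀)) (exp (tl x₀) ⟫ countCode) ⟫ monusCode) (exp x₀)
    [ encodeSubset S • encodeSubset S′ ]↦ unary (∣ S′ ∣ ∸ ∣ S ∣) • (encodeSubset S • encodeSubset S′)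
    ⟨ n * 159 + 200 ⟩
compared {n} S S′ = retime (lemma n)
  (pair-runs
    (⟫-runs (pair-runs (exp-runs (hd x₀)) (⟫-runs (exp-runs (tl x₀)) (count-runs S′))) (monus-runs S ∣ S′ ∣))
    (exp-runs x₀))
  where
  lemma : ∀ n → 9 + ((7 + ((9 + (3 + (7 + (3 + (n * 80 + 79))))) + (n * 79 + 81))) + 2) ≡ n * 159 + 200
  lemma = solve-∀

larger-time : ∀ n → 7 + ((n * 159 + 200) + 13) ≡ n * 159 + 220
larger-time = solve-∀

-- The truncated difference is `nil` exactly when the first set is at least as large, so it can be
-- tested directly. `Q` carries a property of both sets through the choice.
larger-runs : ∀ {n} (Q : Subset n → Set) {S S′ : Subset n} → Q S → Q S′ →
  ∃[ B ] largerCode [ encodeSubset S • encodeSubset S′ ]↦ encodeSubset B ⟨ n * 159 + 220 ⟩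
       × Q B × ∣ S ∣ ≤ ∣ B ∣ × ∣ S′ ∣ ≤ ∣ B ∣
larger-runs {n} Q {S} {S′} qS qS′ with ∣ S′ ∣ ∸ ∣ S ∣ in eq
... | zero =
  S , retime (larger-time n) (⟫-runs (compared S S′) (cond-false (cong unary eq) (exp-runs (hd (tl x₀))))) ,
  qS , ≤-refl , m∸n≡0⇒m≤n eq
... | suc k =
  S′ , retime (larger-time n) (⟫-runs (compared S S′) (cond-true (cong unary eq) (exp-runs (tl (tl x₀))))) ,
  qS′ , <⇒≤ (m∸n≢0⇒n<m (λ eq′ → 0≢1+n (≡.trans (≡.sym eq′) eq))) , ≤-refl

expand : ∀ {n} (M : Subset n) → Subset ∣ M ∣ → Subset n
expand []          []      = []
expand (true ∷ M)  (s ∷ S) = s ∷ expand M S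
expand (false ∷ M) S       = false ∷ expand M S

revExpand : ∀ {n} (M : Subset n) → Subset ∣ M ∣ → Tree → Tree
revExpand []          []      out = out
revExpand (true ∷ M)  (s ∷ S) out = revExpand M S (encodeBool s • out)
revExpand (false ∷ M) S       out = revExpand M S (nil • out)

-- A parallel right fold does not fit, since the shorter vector advances only at the `true`
-- positions of the mask. A left fold consumes it from the front and produces the result in reverse;
-- a second fold restores the order.
expandStep : Code
expandStep = cond (hd x₀)
  (exp (cons (cons (hd (tl (hd (tl x₀)))) (hd (hd (tl x₀)))) (tl (tl (hd (tl x₀))))))
  (exp (cons (cons nil (hd (hd (tl x₀)))) (tl (hd (tl x₀)))))

reverseStep : Exp 1
reverseStep = cons (hd x₀) (hd (tl x₀))

expandCode : Code
expandCode = exp (cons (hd x₀) (cons (cons nil (tl x₀)) nil)) ⟫ fold expandStep ⟫ exp (hd x₀)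
  ⟫ exp (cons x₀ (cons nil nil)) ⟫ fold (exp reverseStep)

expandStep-true : ∀ {s out S env} →
  expandStep [ encodeBool true • ((out • (s • S)) • env) ]↦ (s • out) • S ⟨ 26 ⟩
expandStep-true = cond-true refl (exp-runs _)

expandStep-false : ∀ {out S env} →
  expandStep [ encodeBool false • ((out • S) • env) ]↦ (nil • out) • S ⟨ 26 ⟩
expandStep-false = weaken (≤ᵇ⇒≤ 21 26 _) (cond-false refl (exp-runs _))

revExpand-runs : ∀ {n} (M : Subset n) S {out env} →
  ∃[ Z ] fold expandStep [ encodeSubset M • ((out • encodeSubset S) • env) ]↦ revExpand M S out • Z ⟨ n * 48 + 8 ⟩
revExpand-runs []          []      = _ , fold-nil
revExpand-runs (true ∷ M)  (s ∷ S) = _ , fold-cons expandStep-true (proj₂ (revExpand-runs M S))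
revExpand-runs (false ∷ M) S       = _ , fold-cons expandStep-false (proj₂ (revExpand-runs M S))

reverse-time : ∀ n u → n * 29 + (29 + u) ≡ (29 + n * 29) + u
reverse-time = solve-∀

-- As with `fold-revZip`, the fold that remains on `out` is a parameter, so that the induction can
-- follow `M` although the list is reversed.
reverse-revExpand : ∀ {n} (M : Subset n) S {out env z u} →
  fold (exp reverseStep) [ out • (encodeSubset (expand M S) • env) ]↦ z ⟨ u ⟩ →
  fold (exp reverseStep) [ revExpand M S out • (nil • env) ]↦ z ⟨ n * 29 + u ⟩
reverse-revExpand []          []      k = k
reverse-revExpand {suc n} (true ∷ M)  (s ∷ S) {u = u} k =
  retime (reverse-time n u) (reverse-revExpand M S (fold-cons (exp-runs _) k))
reverse-revExpand {suc n} (false ∷ M) S {u = u} k =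
  retime (reverse-time n u) (reverse-revExpand M S (fold-cons (exp-runs _) k))

expand-runs : ∀ {n} (M : Subset n) S →
  expandCode [ encodeSubset M • encodeSubset S ]↦ encodeSubset (expand M S) ⟨ n * 77 + 63 ⟩
expand-runs {n} M S =
  retime (lemma n)
  (⟫-runs (exp-runs _) (⟫-runs (proj₂ (revExpand-runs M S)) (⟫-runs (exp-runs (hd x₀))
  (⟫-runs (exp-runs (cons x₀ (cons nil nil))) (reverse-revExpand M S fold-nil)))))
  where
  lemma : ∀ n → 7 + (10 + (7 + ((n * 48 + 8) + (7 + (3 + (7 + (6 + (n * 29 + 8)))))))) ≡ n * 77 + 63
  lemma = solve-∀

-- Neighbourhoods

enum : ∀ {n} (M : Subset n) → Fin ∣ M ∣ → Fin n
enum (true ∷ M)  zero    = zero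
enum (true ∷ M)  (suc i) = suc (enum M i)
enum (false ∷ M) i       = suc (enum M i)

enum-injective : ∀ {n} (M : Subset n) {i j} → enum M i ≡ enum M j → i ≡ j
enum-injective (true ∷ M)  {zero}  {zero}  eq = refl
enum-injective (true ∷ M)  {suc i} {suc j} eq = cong suc (enum-injective M (suc-injective eq))
enum-injective (false ∷ M) eq = enum-injective M (suc-injective eq)

enum-∈ : ∀ {n} (M : Subset n) i → enum M i ∈ M
enum-∈ (true ∷ M)  zero    = here
enum-∈ (true ∷ M)  (suc i) = there (enum-∈ M i)
enum-∈ (false ∷ M) i       = there (enum-∈ M i)

enum↣ : ∀ {n} (M : Subset n) → Fin ∣ M ∣ ↣ Fin n
enum↣ M = mk↣ (enum-injective M)

compress-tabulate : ∀ {A : Set} {n} (M : Subset n) (f : Fin n → A) →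
  compress M (tabulate f) ≡ tabulate (f ∘ enum M)
compress-tabulate []          f = refl
compress-tabulate (true ∷ M)  f = cong (f zero ∷_) (compress-tabulate M (f ∘ suc))
compress-tabulate (false ∷ M) f = compress-tabulate M (f ∘ suc)

∈-compress⁻ : ∀ {n} (M S : Subset n) {i} → i ∈ compress M S → enum M i ∈ S
∈-compress⁻ (true ∷ M)  (s ∷ S) here      = here
∈-compress⁻ (true ∷ M)  (s ∷ S) (there p) = there (∈-compress⁻ M S p)
∈-compress⁻ (false ∷ M) (s ∷ S) p         = there (∈-compress⁻ M S p)

∣compress∣ : ∀ {n} (M S : Subset n) → ∣ compress M S ∣ ≡ ∣ M ∩ S ∣
∣compress∣ []          []          = refl
∣compress∣ (true ∷ M)  (true ∷ S)  = cong suc (∣compress∣ M S)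
∣compress∣ (true ∷ M)  (false ∷ S) = ∣compress∣ M S
∣compress∣ (false ∷ M) (s ∷ S)     = ∣compress∣ M S

∈-expand⁻ : ∀ {n} (M : Subset n) S {u} → u ∈ expand M S → ∃[ i ] enum M i ≡ u × i ∈ S
∈-expand⁻ (true ∷ M)  (s ∷ S) here      = zero , refl , here
∈-expand⁻ (true ∷ M)  (s ∷ S) (there p) =
  let i , eq , q = ∈-expand⁻ M S p in suc i , cong suc eq , there q
∈-expand⁻ (false ∷ M) S       (there p) =
  let i , eq , q = ∈-expand⁻ M S p in i , cong suc eq , q

∣expand∣ : ∀ {n} (M : Subset n) S → ∣ expand M S ∣ ≡ ∣ S ∣
∣expand∣ []          []          = refl
∣expand∣ (true ∷ M)  (true ∷ S)  = cong suc (∣expand∣ M S)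
∣expand∣ (true ∷ M)  (false ∷ S) = ∣expand∣ M S
∣expand∣ (false ∷ M) S           = ∣expand∣ M S

module _ {n} (G : Graph n) where

  neighbours : Fin n → Subset n
  neighbours w = tabulate (adj G w)

  neighbourhood : ∀ w → Graph ∣ neighbours w ∣
  neighbourhood w = induced G (enum↣ (neighbours w))

  ∈-neighbours⁺ : ∀ {w u} → Adj G w u → u ∈ neighbours w
  ∈-neighbours⁺ {w} {u} a =
    lookup⇒[]= u _ (≡.trans (lookup∘tabulate (adj G w) u) (Equivalence.to T-≡ a))

  ∈-neighbours⁻ : ∀ {w u} → u ∈ neighbours w → Adj G w u
  ∈-neighbours⁻ {w} {u} p =
    Equivalence.from T-≡ (≡.trans (≡.sym (lookup∘tabulate (adj G w) u)) ([]=⇒lookup p))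

  Adj-sym : ∀ {u v} → Adj G u v → Adj G v u
  Adj-sym {u} {v} = subst T (sym G u v)

  Adj-irrefl : ∀ {u} → ¬ Adj G u u
  Adj-irrefl {u} = subst T (irrefl G u)

  -- `compress` and `enum` list the elements of the mask in the same order, so selecting rows and
  -- columns gives the encoding of the induced graph literally, not just up to isomorphism.
  encode-neighbourhood : ∀ w →
    encodeVec encodeSubset
      (map (compress (neighbours w)) (compress (neighbours w) (tabulate (λ u → tabulate (adj G u)))))
    ≡ encodeGraph (neighbourhood w)
  encode-neighbourhood w = cong (encodeVec encodeSubset) (begin
    map (compress M) (compress M (tabulate (λ u → tabulate (adj G u))))
      ≡⟨ cong (map (compress M)) (compress-tabulate M _) ⟩
    map (compress M) (tabulate (λ i → tabulate (adj G (enum M i))))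
      ≡⟨ tabulate-∘ (compress M) _ ⟨
    tabulate (λ i → compress M (tabulate (adj G (enum M i))))
      ≡⟨ tabulate-cong (λ i → compress-tabulate M _) ⟩
    tabulate (λ i → tabulate (λ j → adj G (enum M i) (enum M j))) ∎)
    where
    open ≡-Reasoning
    M = neighbours w

-- The copy of `H -ᵥ v` is pulled back along `φ` and extended by sending v to w. Enumerating it by
-- the vertices of `H` makes the identity the required isomorphism.
neighbourhood-free : ∀ {m n} (H : Graph (suc m)) {v} (G : Graph n) → Universal H v →
  (H -free) G → ∀ w → ((H -ᵥ v) -free) (neighbourhood G w)
neighbourhood-free {m} {n} H {v} G universal free w g (φ , iso) =
  free (mk↣ f-injective) (↔-id _ , hom)
  where
  M = neighbours G w

  f′ : Fin m → Fin n
  f′ a = enum M (Injection.to g (Inverse.from φ a))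

  f : Fin (suc m) → Fin n
  f x with v ≟ x
  ... | yes _  = w
  ... | no v≢x = f′ (punchOut v≢x)

  adj-w : ∀ a → adj G w (f′ a) ≡ true
  adj-w a = Equivalence.to T-≡ (∈-neighbours⁻ G (enum-∈ M _))

  f′-injective : ∀ {a b} → f′ a ≡ f′ b → a ≡ b
  f′-injective {a} {b} eq = begin
    a                                ≡⟨ Inverse.strictlyInverseˡ φ a ⟨
    Inverse.to φ (Inverse.from φ a)  ≡⟨ cong (Inverse.to φ) (Injection.injective g (enum-injective M eq)) ⟩
    Inverse.to φ (Inverse.from φ b)  ≡⟨ Inverse.strictlyInverseˡ φ b ⟩
    b                                ∎
    where open ≡-Reasoning

  w≢f′ : ∀ a → w ≢ f′ a
  w≢f′ a eq = Adj-irrefl G (subst (λ z → Adj G w z) (≡.sym eq) (Equivalence.from T-≡ (adj-w a)))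

  f-injective : ∀ {x y} → f x ≡ f y → x ≡ y
  f-injective {x} {y} eq with v ≟ x | v ≟ y
  ... | yes refl | yes refl = refl
  ... | yes refl | no  v≢y  = contradiction eq (w≢f′ _)
  ... | no  v≢x  | yes refl = contradiction (≡.sym eq) (w≢f′ _)
  ... | no  v≢x  | no  v≢y  = punchOut-injective v≢x v≢y (f′-injective eq)

  adj-v : ∀ {y} → v ≢ y → adj H v y ≡ true
  adj-v v≢y = Equivalence.to T-≡ (universal _ (v≢y ∘ ≡.sym))

  f′-hom : ∀ a b → adj G (f′ a) (f′ b) ≡ adj H (punchIn v a) (punchIn v b)
  f′-hom a b = ≡.trans (iso _ _)
    (cong₂ (λ a b → adj H (punchIn v a) (punchIn v b))
      (Inverse.strictlyInverseˡ φ a) (Inverse.strictlyInverseˡ φ b))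

  hom : ∀ x y → adj G (f x) (f y) ≡ adj H x y
  hom x y with v ≟ x | v ≟ y
  ... | yes refl | yes refl = ≡.trans (irrefl G w) (≡.sym (irrefl H v))
  ... | yes refl | no  v≢y  = ≡.trans (adj-w _) (≡.sym (adj-v v≢y))
  ... | no  v≢x  | yes refl =
    ≡.trans (≡.trans (sym G _ w) (adj-w _)) (≡.sym (≡.trans (sym H x v) (adj-v v≢x)))
  ... | no  v≢x  | no  v≢y  =
    ≡.trans (f′-hom _ _) (cong₂ (adj H) (punchIn-punchOut v≢x) (punchIn-punchOut v≢y))

-- Independent sets

∈-allSubsets : ∀ {n} (S : Subset n) → S ∈ᴸ allSubsets n
∈-allSubsets []          = here refl
∈-allSubsets (true ∷ S)  = ∈-++⁺ˡ (∈-map⁺ (inside ∷_) (∈-allSubsets S))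
∈-allSubsets {suc n} (false ∷ S) = ∈-++⁺ʳ (List.map (inside ∷_) (allSubsets n)) (∈-map⁺ (outside ∷_) (∈-allSubsets S))

⊥-independent : ∀ {n} (G : Graph n) → Independent G ⊥
⊥-independent G u v u∈⊥ = ⊥-elim (∉⊥ u∈⊥)

independent⇒≤α : ∀ {n} {G : Graph n} {S} → Independent G S → ∣ S ∣ ≤ α G
independent⇒≤α {G = G} {S} ind =
  All.lookup (xs≤max 0 _) (∈-map⁺ ∣_∣ (∈-filter⁺ (independent? G) (∈-allSubsets S) ind))

α-attained : ∀ {n} (G : Graph n) → ∃[ O ] Independent G O × ∣ O ∣ ≡ α G
α-attained {n} G with argmax-sel id 0 (List.map ∣_∣ (List.filter (independent? G) (allSubsets n)))
-- Here `max` returned its default 0, which the empty set attains.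
... | inj₁ α≡0 = ⊥ , ⊥-independent G , ≡.trans (∣⊥∣≡0 n) (≡.sym α≡0)
... | inj₂ α∈  =
  let O , O∈ , α≡∣O∣ = ∈-map⁻ ∣_∣ α∈
  in O , proj₂ (∈-filter⁻ (independent? G) {xs = allSubsets n} O∈) , ≡.sym α≡∣O∣

∣neighbours∩O∣≤α : ∀ {n} {G : Graph n} {O} → Independent G O → ∀ w →
  ∣ neighbours G w ∩ O ∣ ≤ α (neighbourhood G w)
∣neighbours∩O∣≤α {G = G} {O} ind w =
  subst (_≤ α (neighbourhood G w)) (∣compress∣ M O)
    (independent⇒≤α {G = neighbourhood G w} λ u v u∈ v∈ → ind _ _ (∈-compress⁻ M O u∈) (∈-compress⁻ M O v∈))
  where M = neighbours G w

expand-independent : ∀ {n} {G : Graph n} {w S} → Independent (neighbourhood G w) S →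
  Independent G (expand (neighbours G w) S)
expand-independent {G = G} {w} {S} ind u v u∈ v∈ with ∈-expand⁻ (neighbours G w) S u∈ | ∈-expand⁻ (neighbours G w) S v∈
... | i , refl , i∈S | j , refl , j∈S = ind i j i∈S j∈S

∣p∣≤∣q∣+∣p─q∣ : ∀ {n} (p q : Subset n) → ∣ p ∣ ≤ ∣ q ∣ + ∣ p ─ q ∣
∣p∣≤∣q∣+∣p─q∣ []          []          = z≤n
∣p∣≤∣q∣+∣p─q∣ (true ∷ p)  (true ∷ q)  = s≤s (∣p∣≤∣q∣+∣p─q∣ p q)
∣p∣≤∣q∣+∣p─q∣ (true ∷ p)  (false ∷ q) =
  ≤-trans (s≤s (∣p∣≤∣q∣+∣p─q∣ p q)) (≤-reflexive (≡.sym (+-suc ∣ q ∣ ∣ p ─ q ∣)))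
∣p∣≤∣q∣+∣p─q∣ (false ∷ p) (true ∷ q)  = m≤n⇒m≤1+n (∣p∣≤∣q∣+∣p─q∣ p q)
∣p∣≤∣q∣+∣p─q∣ (false ∷ p) (false ∷ q) = ∣p∣≤∣q∣+∣p─q∣ p q

x∈p─q⇒x∉q : ∀ {n} {x : Fin n} (p q : Subset n) → x ∈ p ─ q → x ∉ q
x∈p─q⇒x∉q (b ∷ p) (true ∷ q) () here
x∈p─q⇒x∉q (b ∷ p) (c ∷ q) (there x∈) (there x∈q) = x∈p─q⇒x∉q p q x∈ x∈q

-- A union bound by induction along the positions of `S`: the set of each member is subtracted from
-- `P`, and what is left is covered by the later members.
∣cover∣ : ∀ {k n b} (S : Subset k) (F : Fin k → Subset n) (P : Subset n) →
  (∀ {x} → x ∈ P → ∃[ s ] s ∈ S × x ∈ F s) → (∀ {s} → s ∈ S → ∣ F s ∣ ≤ b) → ∣ P ∣ ≤ ∣ S ∣ * b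
∣cover∣ {n = n} [] F P covers bound =
  ≤-trans (p⊆q⇒∣p∣≤∣q∣ {p = P} {⊥} (λ x∈P → case (covers x∈P))) (≤-reflexive (∣⊥∣≡0 n))
  where
  case : ∀ {A : Set} {x} → ∃[ s ] s ∈ [] × x ∈ F s → A
  case (() , _)
∣cover∣ (true ∷ S) F P covers bound =
  ≤-trans (∣p∣≤∣q∣+∣p─q∣ P (F zero))
    (+-mono-≤ (bound here) (∣cover∣ S (F ∘ suc) (P ─ F zero) rest (bound ∘ there)))
  where
  rest : ∀ {x} → x ∈ P ─ F zero → ∃[ s ] s ∈ S × x ∈ F (suc s)
  rest x∈ with covers (p─q⊆p P (F zero) x∈)
  ... | zero  , _       , x∈F = contradiction x∈F (x∈p─q⇒x∉q P (F zero) x∈)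
  ... | suc s , there p , x∈F = s , p , x∈F
∣cover∣ (false ∷ S) F P covers bound = ∣cover∣ S (F ∘ suc) P rest (bound ∘ there)
  where
  rest : ∀ {x} → x ∈ P → ∃[ s ] s ∈ S × x ∈ F (suc s)
  rest x∈ with covers x∈
  ... | suc s , there p , x∈F = s , p , x∈F

Dominates : ∀ {n} → Graph n → Subset n → Fin n → Set
Dominates G S u = u ∈ S ⊎ ∃[ s ] s ∈ S × Adj G u s

-- An optimal set O is covered by the sets {s} with s ∈ S ∩ O and N(s) ∩ O with s ∈ S ∖ O.
α≤∣S∣*b : ∀ {n} (G : Graph n) {S b} → (∀ u → Dominates G S u) →
  ∣ S ∣ ≤ b → (∀ w → α (neighbourhood G w) ≤ b) → α G ≤ ∣ S ∣ * b
α≤∣S∣*b {n} G {S} {b} dominating ∣S∣≤b local with α-attained G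
... | O , ind , ∣O∣≡α = subst (_≤ ∣ S ∣ * b) ∣O∣≡α (∣cover∣ S F O covers bound)
  where
  F : Fin n → Subset n
  F s with s ∈? O
  ... | yes _ = ⁅ s ⁆
  ... | no  _ = neighbours G s ∩ O

  covers : ∀ {x} → x ∈ O → ∃[ s ] s ∈ S × x ∈ F s
  covers {x} x∈O with dominating x
  ... | inj₁ x∈S = x , x∈S , member
    where
    member : x ∈ F x
    member with x ∈? O
    ... | yes _  = x∈⁅x⁆ x
    ... | no x∉O = contradiction x∈O x∉O
  ... | inj₂ (s , s∈S , x~s) = s , s∈S , member
    where
    member : x ∈ F s
    member with s ∈? O
    ... | yes s∈O = contradiction x~s (ind x s x∈O s∈O)
    ... | no  _   = x∈p∩q⁺ (∈-neighbours⁺ G (Adj-sym G x~s) , x∈O)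

  1≤∣S∣ : ∀ {s} → s ∈ S → 1 ≤ ∣ S ∣
  1≤∣S∣ {s} s∈S = subst (_≤ ∣ S ∣) (∣⁅x⁆∣≡1 s)
    (p⊆q⇒∣p∣≤∣q∣ λ x∈ → subst (_∈ S) (≡.sym (x∈⁅y⁆⇒x≡y s x∈)) s∈S)

  bound : ∀ {s} → s ∈ S → ∣ F s ∣ ≤ b
  bound {s} s∈S with s ∈? O
  -- A singleton fits below b because `S` is nonempty and has at most b elements.
  ... | yes _ = ≤-trans (≤-reflexive (∣⁅x⁆∣≡1 s)) (≤-trans (1≤∣S∣ s∈S) ∣S∣≤b)
  ... | no  _ = ≤-trans (∣neighbours∩O∣≤α {G = G} ind s) (local s)

-- The greedy maximal independent set

meets-true : ∀ {n} (M S : Subset n) → meets M S ≡ true → ∃[ i ] i ∈ M × i ∈ S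
meets-true []          []          ()
meets-true (true ∷ M)  (true ∷ S)  eq = zero , here , here
meets-true (true ∷ M)  (false ∷ S) eq = let i , p , q = meets-true M S eq in suc i , there p , there q
meets-true (false ∷ M) (s ∷ S)     eq = let i , p , q = meets-true M S eq in suc i , there p , there q

meets-false : ∀ {n} (M S : Subset n) → meets M S ≡ false → ∀ {i} → i ∈ M → ¬ (i ∈ S)
meets-false (true ∷ M)  (false ∷ S) eq (there p) (there q) = meets-false M S eq p q
meets-false (false ∷ M) (s ∷ S)     eq (there p) (there q) = meets-false M S eq p q

-- The position k, in a form that represents the singleton ⁅ k ⁆.
cursor : ℕ → Tree
cursor zero    = (nil • nil) • nil
cursor (suc k) = nil • cursor k

cursor-represents : ∀ {n} (i : Fin n) → cursor (toℕ i) Represents ⁅ i ⁆ by encodeBool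
cursor-represents {suc n} zero    = refl ∷ nil-represents n
cursor-represents         (suc i) = refl ∷ cursor-represents i

-- The fold hands over the row of a vertex but not its index. The row decides whether the vertex has
-- a neighbour in S; the cursor, lengthened by one `nil` per step, supplies the singleton to be
-- added.
greedyStep : Code
greedyStep =
  pair (pair (exp (cons (hd x₀) (hd (hd (tl x₀)))) ⟫ meetsCode)
             (exp (cons (hd (hd (tl x₀))) (tl (hd (tl x₀)))))
        ⟫ cond (hd x₀) (exp (hd (tl x₀))) (exp (tl x₀) ⟫ unionCode))
       (exp (cons nil (tl (hd (tl x₀)))))

greedyCode : Code
greedyCode =
  pair (exp x₀) (pair (pair emptyCode (exp (cons (cons nil nil) nil))) (exp nil))
  ⟫ fold greedyStep ⟫ exp (hd x₀)

-- The running times are left in the shape in which the combinators produce them.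
greedyStepTime greedyTime : ℕ → ℕ
greedyStepTime n = 9 + ((7 + ((9 + ((7 + (8 + (n * 88 + 77))) + 10)) + (n * 82 + 96))) + 7)
greedyTime n =
  7 + ((9 + (2 + (9 + ((9 + ((n * 70 + 79) + 6)) + 2)))) + (7 + ((n * (22 + greedyStepTime n) + 8) + 3)))

compare : ∀ {n} (M S : Subset n) {C} →
  pair (exp (cons (hd x₀) (hd (hd (tl x₀)))) ⟫ meetsCode) (exp (cons (hd (hd (tl x₀))) (tl (hd (tl x₀)))))
    [ encodeSubset M • ((encodeSubset S • C) • nil) ]↦ encodeBool (meets M S) • (encodeSubset S • C)
    ⟨ 9 + ((7 + (8 + (n * 88 + 77))) + 10) ⟩
compare M S = pair-runs (⟫-runs (exp-runs _) (meets-runs M S)) (exp-runs _)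

greedyStep-meets : ∀ {n} (M S : Subset n) {C} → meets M S ≡ true →
  greedyStep [ encodeSubset M • ((encodeSubset S • C) • nil) ]↦ encodeSubset S • (nil • C) ⟨ greedyStepTime n ⟩
greedyStep-meets {n} M S eq =
  pair-runs
    (⟫-runs (compare M S)
      (weaken (≤-trans (≤ᵇ⇒≤ 13 96 _) (m≤n+m 96 (n * 82)))
        (cond-true (cong encodeBool eq) (exp-runs _))))
    (exp-runs _)

greedyStep-misses : ∀ {n} (M S : Subset n) (i : Fin n) → meets M S ≡ false →
  greedyStep [ encodeSubset M • ((encodeSubset S • cursor (toℕ i)) • nil) ]↦
    encodeSubset (S ∪ ⁅ i ⁆) • cursor (suc (toℕ i)) ⟨ greedyStepTime n ⟩
greedyStep-misses {n} M S i eq =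
  pair-runs
    (⟫-runs (compare M S)
      (retime (lemma n)
        (cond-false (cong encodeBool eq) (⟫-runs (exp-runs (tl x₀)) (union-runs S (cursor-represents i))))))
    (exp-runs _)
  where
  lemma : ∀ n → 7 + (2 + (7 + (3 + (n * 82 + 77)))) ≡ n * 82 + 96
  lemma = solve-∀

extend : ∀ {n} {P : Fin n → Set} i → P i → (∀ u → toℕ u < toℕ i → P u) → ∀ u → toℕ u < suc (toℕ i) → P u
extend i pᵢ p u u<1+i with m≤n⇒m<n∨m≡n (≤-pred u<1+i)
... | inj₁ u<i = p u u<i
... | inj₂ u≡i rewrite toℕ-injective u≡i = pᵢ

module _ {n} (G : Graph n) where

  insert-independent : ∀ {S u} → Independent G S → (∀ {s} → s ∈ S → ¬ Adj G u s) →
    Independent G (S ∪ ⁅ u ⁆)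
  insert-independent {S} {u} ind misses x y x∈ y∈ x~y with x∈p∪q⁻ S ⁅ u ⁆ x∈ | x∈p∪q⁻ S ⁅ u ⁆ y∈
  ... | inj₁ x∈S | inj₁ y∈S = ind x y x∈S y∈S x~y
  ... | inj₁ x∈S | inj₂ y∈u rewrite x∈⁅y⁆⇒x≡y u y∈u = misses x∈S (Adj-sym G x~y)
  ... | inj₂ x∈u | inj₁ y∈S rewrite x∈⁅y⁆⇒x≡y u x∈u = misses y∈S x~y
  ... | inj₂ x∈u | inj₂ y∈u rewrite x∈⁅y⁆⇒x≡y u x∈u | x∈⁅y⁆⇒x≡y u y∈u = Adj-irrefl G x~y

  insert-dominates : ∀ {S} u {v} → Dominates G S v → Dominates G (S ∪ ⁅ u ⁆) v
  insert-dominates u (inj₁ v∈S)             = inj₁ (p⊆p∪q ⁅ u ⁆ v∈S)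
  insert-dominates u (inj₂ (s , s∈S , v~s)) = inj₂ (s , p⊆p∪q ⁅ u ⁆ s∈S , v~s)

  -- Domination is claimed only for the vertices visited so far; as S only grows, it is never lost.
  GreedyInvariant : ℕ → Tree → Set
  GreedyInvariant k acc = ∃[ S ]
    acc ≡ encodeSubset S • cursor k × Independent G S × (∀ u → toℕ u < k → Dominates G S u)

  greedyStep-runs : ∀ i {acc} → GreedyInvariant (toℕ i) acc → ∃[ acc′ ]
    greedyStep [ encodeSubset (neighbours G i) • (acc • nil) ]↦ acc′ ⟨ greedyStepTime n ⟩
    × GreedyInvariant (suc (toℕ i)) acc′
  greedyStep-runs i (S , refl , ind , dom) with meets (neighbours G i) S in eq
  ... | true =
    let s , s∈N , s∈S = meets-true (neighbours G i) S eq
    in _ , greedyStep-meets (neighbours G i) S eq ,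
       S , refl , ind , extend i (inj₂ (s , s∈S , ∈-neighbours⁻ G s∈N)) dom
  ... | false =
    _ , greedyStep-misses (neighbours G i) S i eq ,
    S ∪ ⁅ i ⁆ , refl ,
    insert-independent ind (λ s∈S i~s → meets-false (neighbours G i) S eq (∈-neighbours⁺ G i~s) s∈S) ,
    extend i (inj₁ (q⊆p∪q S ⁅ i ⁆ (x∈⁅x⁆ i))) (λ u u<i → insert-dominates i (dom u u<i))

  greedy-runs : ∃[ S ] greedyCode [ encodeGraph G ]↦ encodeSubset S ⟨ greedyTime n ⟩
    × Independent G S × (∀ u → Dominates G S u)
  greedy-runs with fold-tabulate GreedyInvariant encodeSubset (neighbours G) greedyStep-runs
    (⊥ , refl , ⊥-independent G , λ u ())
  ... | _ , p , S , refl , ind , dom =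
    S ,
    ⟫-runs
      (pair-runs (exp-runs x₀)
        -- The expression `cons (cons nil nil) nil` evaluates to `cursor 0`.
        (pair-runs (pair-runs (empty-runs encodeSubset (tabulate (neighbours G))) (exp-runs (cons (cons nil nil) nil)))
          (exp-runs nil)))
      (⟫-runs p (exp-runs (hd x₀))) ,
    ind , λ u → dom u (toℕ<n u)

-- The approximation algorithm

-- The outer `select` keeps the rows of the neighbours, the inner one their columns; the mask is
-- therefore both selector and environment.
neighbourhoodCode : Code
neighbourhoodCode = exp (cons x₀ (hd x₀)) ⟫ select (exp (cons (cons (tl x₀) (hd x₀)) nil) ⟫ select (exp (hd x₀)))

neighbourhoodTime : ℕ → ℕ
neighbourhoodTime n = 7 + (5 + (n * (102 + (7 + (8 + (n * 105 + 79)))) + 79))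

neighbourhood-runs : ∀ {n} (G : Graph n) w →
  neighbourhoodCode [ encodeSubset (neighbours G w) • encodeGraph G ]↦ encodeGraph (neighbourhood G w)
    ⟨ neighbourhoodTime n ⟩
neighbourhood-runs {n} G w =
  returns (encode-neighbourhood G w)
    (⟫-runs (exp-runs (cons x₀ (hd x₀)))
      (select-runs (compress M) row-runs M (tabulate (neighbours G))))
  where
  M = neighbours G w
  row-runs : ∀ (R : Subset n) →
    exp (cons (cons (tl x₀) (hd x₀)) nil) ⟫ select (exp (hd x₀)) [ encodeSubset R • encodeSubset M ]↦
      encodeSubset (compress M R) ⟨ 7 + (8 + (n * 105 + 79)) ⟩
  row-runs R = ⟫-runs (exp-runs (cons (cons (tl x₀) (hd x₀)) nil))
    (returns (cong encodeSubset (map-id (compress M R)))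
      (select-runs (λ b → b) (λ b → exp-runs (hd x₀)) M R))

module _ (A : Program) where

  -- In the final fold the graph plays two parts, as the list of rows and as the environment from
  -- which neighbourhoods are extracted; the greedy set is the initial accumulator.
  candidateCode improveStep approximate : Code
  candidateCode =
    pair (exp (hd x₀)) (exp (cons (hd x₀) (tl (tl x₀))) ⟫ neighbourhoodCode ⟫ resetting A) ⟫ expandCode
  improveStep = pair (exp (hd (tl x₀))) candidateCode ⟫ largerCode
  approximate = pair (exp x₀) greedyCode ⟫ exp (cons (hd x₀) (cons (tl x₀) (hd x₀))) ⟫ fold improveStep

  module _ (time : ℕ → ℕ) where

    candidateTime improveTime approximateTime : ℕ → ℕ
    candidateTime n =
      7 + ((9 + (3 + (7 + (7 + (7 + (neighbourhoodTime n + (resetTime A + time n))))))) + (n * 77 + 63))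
    improveTime n = 7 + ((9 + (4 + candidateTime n)) + (n * 159 + 220))
    approximateTime n = 7 + ((9 + (2 + greedyTime n)) + (7 + (9 + (n * (22 + improveTime n) + 8))))

    module _ {n} (G : Graph n)
      (solve : ∀ w → ∃[ S ] ∃[ t ] Runs A (encodeGraph (neighbourhood G w)) (encodeSubset S) t
        × t ≤ time n × MaximumIndependent (neighbourhood G w) S)
      {S : Subset n}
      where

      -- At k = n the last two clauses are the hypotheses of `α≤∣S∣*b` for b = |B|; of each I(w)
      -- only the size is recorded.
      ImproveInvariant : ℕ → Tree → Set
      ImproveInvariant k acc = ∃[ B ] acc ≡ encodeSubset B × Independent G B × ∣ S ∣ ≤ ∣ B ∣
        × (∀ u → toℕ u < k → α (neighbourhood G u) ≤ ∣ B ∣)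

      candidate-runs : ∀ w (B : Subset n) → ∃[ C ]
        candidateCode [ encodeSubset (neighbours G w) • (encodeSubset B • encodeGraph G) ]↦ encodeSubset C
          ⟨ candidateTime n ⟩
        × Independent G C × ∣ C ∣ ≡ α (neighbourhood G w)
      candidate-runs w B with solve w
      ... | I , t , run , t≤ , ind , ∣I∣≡α =
        expand M I ,
        ⟫-runs
          (pair-runs (exp-runs (hd x₀))
            (⟫-runs (exp-runs (cons (hd x₀) (tl (tl x₀))))
            (⟫-runs (neighbourhood-runs G w) (weaken (+-monoʳ-≤ (resetTime A) t≤) (resetting-runs run)))))
          (expand-runs M I) ,
        expand-independent {G = G} ind , ≡.trans (∣expand∣ M I) ∣I∣≡α
        where M = neighbours G w

      improveStep-runs : ∀ i {acc} → ImproveInvariant (toℕ i) acc → ∃[ acc′ ]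
        improveStep [ encodeSubset (neighbours G i) • (acc • encodeGraph G) ]↦ acc′ ⟨ improveTime n ⟩
        × ImproveInvariant (suc (toℕ i)) acc′
      improveStep-runs i (B , refl , ind , ∣S∣≤ , local) =
        let C , runC , indC , ∣C∣≡α = candidate-runs i B
            D , runD , indD , ∣B∣≤ , ∣C∣≤ = larger-runs (Independent G) ind indC
        in encodeSubset D , ⟫-runs (pair-runs (exp-runs (hd (tl x₀))) runC) runD ,
           D , refl , indD , ≤-trans ∣S∣≤ ∣B∣≤ ,
           extend i (subst (_≤ ∣ D ∣) ∣C∣≡α ∣C∣≤) (λ u u<i → ≤-trans (local u u<i) ∣B∣≤)

    approximate-runs : ∀ {n} (G : Graph n) →
      (∀ w → ∃[ S ] ∃[ t ] Runs A (encodeGraph (neighbourhood G w)) (encodeSubset S) t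
        × t ≤ time n × MaximumIndependent (neighbourhood G w) S) →
      ∃[ B ] approximate [ encodeGraph G ]↦ encodeSubset B ⟨ approximateTime n ⟩ × √OPT-Approximate G B
    approximate-runs G solve with greedy-runs G
    ... | S , greedy , indS , dom with fold-tabulate (ImproveInvariant G solve {S}) encodeSubset (neighbours G)
        (improveStep-runs G solve {S}) (S , refl , indS , ≤-refl , λ u ())
    ... | _ , p , B , refl , indB , ∣S∣≤∣B∣ , local =
      B ,
      ⟫-runs (pair-runs (exp-runs x₀) greedy)
        (⟫-runs (exp-runs (cons (hd x₀) (cons (tl x₀) (hd x₀)))) p) ,
      indB , bound
      where
      open ≤-Reasoning
      bound : α G ≤ ∣ B ∣ ^ 2
      bound = begin
        α G             ≤⟨ α≤∣S∣*b G {S} dom ∣S∣≤∣B∣ (λ w → local w (toℕ<n w)) ⟩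
        ∣ S ∣ * ∣ B ∣   ≤⟨ *-monoˡ-≤ ∣ B ∣ ∣S∣≤∣B∣ ⟩
        ∣ B ∣ * ∣ B ∣   ≡⟨ cong (∣ B ∣ *_) (*-identityʳ ∣ B ∣) ⟨
        ∣ B ∣ ^ 2       ∎

-- Polynomial bounds

-- The base suc n makes the powers monotone in the exponent.
PolyBounded : (ℕ → ℕ) → Set
PolyBounded f = ∃[ c ] ∃[ d ] ∀ n → f n ≤ c * suc n ^ d

infixl 6 _+ᵖ_
infixl 7 _*ᵖ_
infixl 8 _^ᵖ_

constᵖ : ∀ k → PolyBounded (λ _ → k)
constᵖ k = k , 0 , λ n → ≤-reflexive (≡.sym (*-identityʳ k))

idᵖ : PolyBounded (λ n → n)
idᵖ = 1 , 1 , λ n → ≤-trans (n≤1+n n) (≤-reflexive (lemma (suc n)))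
  where
  lemma : ∀ m → m ≡ 1 * (m * 1)
  lemma = solve-∀

_*ᵖ_ : ∀ {f g} → PolyBounded f → PolyBounded g → PolyBounded (λ n → f n * g n)
_*ᵖ_ {f} {g} (c , d , p) (c′ , d′ , q) = c * c′ , d + d′ , λ n → begin
  f n * g n                               ≤⟨ *-mono-≤ (p n) (q n) ⟩
  (c * suc n ^ d) * (c′ * suc n ^ d′)     ≡⟨ lemma c (suc n ^ d) c′ (suc n ^ d′) ⟩
  c * c′ * (suc n ^ d * suc n ^ d′)       ≡⟨ cong (c * c′ *_) (^-distribˡ-+-* (suc n) d d′) ⟨
  c * c′ * suc n ^ (d + d′)               ∎
  where
  open ≤-Reasoning
  lemma : ∀ a b c d → (a * b) * (c * d) ≡ a * c * (b * d)
  lemma = solve-∀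

_+ᵖ_ : ∀ {f g} → PolyBounded f → PolyBounded g → PolyBounded (λ n → f n + g n)
_+ᵖ_ {f} {g} (c , d , p) (c′ , d′ , q) = c + c′ , d + d′ , λ n → begin
  f n + g n                                       ≤⟨ +-mono-≤ (p n) (q n) ⟩
  c * suc n ^ d + c′ * suc n ^ d′
    ≤⟨ +-mono-≤ (*-monoʳ-≤ c (^-monoʳ-≤ (suc n) (m≤m+n d d′))) (*-monoʳ-≤ c′ (^-monoʳ-≤ (suc n) (m≤n+m d′ d))) ⟩
  c * suc n ^ (d + d′) + c′ * suc n ^ (d + d′)    ≡⟨ *-distribʳ-+ (suc n ^ (d + d′)) c c′ ⟨
  (c + c′) * suc n ^ (d + d′)                     ∎
  where open ≤-Reasoning

_^ᵖ_ : ∀ {f} → PolyBounded f → ∀ d → PolyBounded (λ n → f n ^ d)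
p ^ᵖ zero  = constᵖ 1
p ^ᵖ suc d = p *ᵖ (p ^ᵖ d)

^-distribʳ-* : ∀ d a b → (a * b) ^ d ≡ a ^ d * b ^ d
^-distribʳ-* zero    a b = refl
^-distribʳ-* (suc d) a b =
  ≡.trans (cong (a * b *_) (^-distribʳ-* d a b)) ([m*n]*[o*p]≡[m*o]*[n*p] a b (a ^ d) (b ^ d))

-- For n ≥ 1 the base satisfies `suc n ≤ 2 * n`; the summand `2 ^ d` covers n = 0.
suc^≤ : ∀ n d → suc n ^ d ≤ 2 ^ d * n ^ d + 2 ^ d
suc^≤ zero    d = ≤-trans (≤-reflexive (^-zeroˡ d)) (≤-trans (m^n>0 2 d) (m≤n+m (2 ^ d) _))
suc^≤ (suc n) d = begin
  suc (suc n) ^ d                 ≤⟨ ^-monoˡ-≤ d (≤-trans (m≤m+n (suc (suc n)) n) (≤-reflexive (lemma n))) ⟩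
  (2 * suc n) ^ d                 ≡⟨ ^-distribʳ-* d 2 (suc n) ⟩
  2 ^ d * suc n ^ d               ≤⟨ m≤m+n _ (2 ^ d) ⟩
  2 ^ d * suc n ^ d + 2 ^ d       ∎
  where
  open ≤-Reasoning
  lemma : ∀ n → 2 + n + n ≡ 2 * (1 + n)
  lemma = solve-∀

polynomial : ∀ {f} → PolyBounded f → ∃[ c ] ∃[ d ] ∀ n → f n ≤ c * n ^ d + c
polynomial {f} (c , d , p) = c * 2 ^ d , d , λ n → begin
  f n                              ≤⟨ p n ⟩
  c * suc n ^ d                    ≤⟨ *-monoʳ-≤ c (suc^≤ n d) ⟩
  c * (2 ^ d * n ^ d + 2 ^ d)      ≡⟨ lemma c (2 ^ d) (n ^ d) ⟩
  c * 2 ^ d * n ^ d + c * 2 ^ d    ∎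
  where
  open ≤-Reasoning
  lemma : ∀ a b c → a * (b * c + b) ≡ a * b * c + a * b
  lemma = solve-∀

affineᵖ : ∀ a b → PolyBounded (λ n → n * a + b)
affineᵖ a b = idᵖ *ᵖ constᵖ a +ᵖ constᵖ b

offsetᵖ : ∀ {f} k → PolyBounded f → PolyBounded (λ n → k + f n)
offsetᵖ k p = constᵖ k +ᵖ p

-- The combinators mirror the arithmetic expression term by term, so the bound type checks by
-- unfolding `greedyTime`.
greedyTimeᵖ : PolyBounded greedyTime
greedyTimeᵖ =
  offsetᵖ 7 (offsetᵖ 9 (offsetᵖ 2 (offsetᵖ 9 (offsetᵖ 9 (affineᵖ 70 79 +ᵖ constᵖ 6) +ᵖ constᵖ 2)))
    +ᵖ offsetᵖ 7 (idᵖ *ᵖ offsetᵖ 22 greedyStepTimeᵖ +ᵖ constᵖ 8 +ᵖ constᵖ 3))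
  where
  greedyStepTimeᵖ : PolyBounded greedyStepTime
  greedyStepTimeᵖ =
    offsetᵖ 9 (offsetᵖ 7 (offsetᵖ 9 (offsetᵖ 7 (offsetᵖ 8 (affineᵖ 88 77)) +ᵖ constᵖ 10) +ᵖ affineᵖ 82 96) +ᵖ constᵖ 7)

neighbourhoodTimeᵖ : PolyBounded neighbourhoodTime
neighbourhoodTimeᵖ =
  offsetᵖ 7 (offsetᵖ 5 (idᵖ *ᵖ offsetᵖ 102 (offsetᵖ 7 (offsetᵖ 8 (affineᵖ 105 79))) +ᵖ constᵖ 79))

approximateTimeᵖ : ∀ A {time} → PolyBounded time → PolyBounded (approximateTime A time)
approximateTimeᵖ A {time} timeᵖ =
  offsetᵖ 7 (offsetᵖ 9 (offsetᵖ 2 greedyTimeᵖ)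
    +ᵖ offsetᵖ 7 (offsetᵖ 9 (idᵖ *ᵖ offsetᵖ 22 improveTimeᵖ +ᵖ constᵖ 8)))
  where
  improveTimeᵖ : PolyBounded (improveTime A time)
  improveTimeᵖ =
    offsetᵖ 7 (offsetᵖ 9 (offsetᵖ 4 (offsetᵖ 7
      (offsetᵖ 9 (offsetᵖ 3 (offsetᵖ 7 (offsetᵖ 7 (offsetᵖ 7 (neighbourhoodTimeᵖ +ᵖ offsetᵖ (resetTime A) timeᵖ)))))
        +ᵖ affineᵖ 77 63)))
      +ᵖ affineᵖ 159 220)

theorem14 : ∀ {m : ℕ} (H : Graph m) → LocallyEasy H → PolyTimeAlgorithm (H -free) √OPT-Approximate
-- The vertex v forces `H` to be nonempty, so order zero does not occur.
theorem14 {suc m} H (v , universal , exact) = record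
  { program = compile (approximate A)
  ; c       = proj₁ bound
  ; d       = proj₁ (proj₂ bound)
  ; correct = correct
  }
  where
  open PolyTimeAlgorithm exact using () renaming (program to A; c to cₑ; d to dₑ; correct to exact-correct)

  time : ℕ → ℕ
  time n = cₑ * n ^ dₑ + cₑ

  bound : ∃[ c ] ∃[ d ] ∀ n → approximateTime A time n ≤ c * n ^ d + c
  bound = polynomial (approximateTimeᵖ A (constᵖ cₑ *ᵖ (idᵖ ^ᵖ dₑ) +ᵖ constᵖ cₑ))

  correct : ∀ {n} (G : Graph n) → (H -free) G → ∃[ S ] ∃[ t ]
    Runs (compile (approximate A)) (encodeGraph G) (encodeSubset S) t
    × t ≤ proj₁ bound * n ^ proj₁ (proj₂ bound) + proj₁ bound × √OPT-Approximate G S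
  correct {n} G free =
    let S , p , good = approximate-runs A time G solve
        ρ , t , run , t≤ = _[_]↦_⟨_⟩.run p _
    in S , t , (_ , run , refl) , ≤-trans t≤ (proj₂ (proj₂ bound) n) , good
    where
    solve : ∀ w → ∃[ S ] ∃[ t ] Runs A (encodeGraph (neighbourhood G w)) (encodeSubset S) t
      × t ≤ time n × MaximumIndependent (neighbourhood G w) S
    solve w =
      let S , t , run , t≤ , max = exact-correct (neighbourhood G w) (neighbourhood-free H G universal free w)
      in S , t , run ,
         -- The exact algorithm is timed by |N(w)|; monotonicity replaces this by n, which gives one
         -- bound for all iterations.
         ≤-trans t≤ (+-monoˡ-≤ cₑ (*-monoʳ-≤ cₑ (^-monoˡ-≤ dₑ (∣p∣≤n (neighbours G w))))) , max
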